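{- Work in ZF (without assuming the axiom of choice). Suppose that every well-specified game has a pure-strategy Nash equilibrium. Then the axiom of choice holds: for every family $(X_i)_{i\in I}$ of nonempty sets, the Cartesian product $\prod_{i\in I}X_i$ is nonempty.
   Context: Hyperspace: for a topological space $X$, $C(X)$ denotes the set of nonempty closed subsets of $X$, equipped with the upper Vietoris topology, which has as a basis the sets $\{K\in C(X)\colon K\subset U\}$ with $U\subset X$ open. Preregular: two points of a topological space are topologically distinguishable if there is an open set containing one but not the other; a space is preregular if any two topologically distinguishable points can be separated by disjoint open neighborhoods. Compact does not include Hausdorff. Game: a family of nonempty topological spaces $(S_i)_{i\in I}$ (strategy spaces), indexed by a possibly infinite set $I$ containing at least two elements, together with, for each $i\in I$, a best-response correspondence, which is a continuous function $\mathrm{BR}_i\colon S_{ -i}\to C(S_i)$. Here $S=\prod_{i\in I}S_i$ and $S_{ -i}=\prod_{j\neq i}S_j$ carry the product topologies; without choice these products are defined but are not assumed to be nonempty. For $s\in S$, $s_i$ is its $i$th coordinate and $s_{ -i}\in S_{ -i}$ is $s$ with the $i$th coordinate removed. Pure-strategy Nash equilibrium: a point $s\in S$ with $s_i\in \mathrm{BR}_i(s_{ -i})$ for every $i\in I$. Reduction: for $J\subset I$ with at least two elements, let $S_J=\prod_{i\in J}S_i$ and $S_{ -J}=\prod_{i\in I\setminus J}S_i$. For a point $p\in S_{ -J}$, the reduction around $p$ is the game with index set $J$, strategy spaces $S_i$ ($i\in J$), and best-response correspondences $\mathrm{BR}_i(p,\cdot)\colon \prod_{j\in J\setminus\{i\}}S_j\to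 C(S_i)$ ($i\in J$), i.e. the players outside $J$ have their strategies fixed to be those given by $p$. If $J=I$, the unique corresponding reduction is the original game. A reduction is finite if $J$ is finite. Well-specified: a game is well-specified if (1) each $S_i$ is nonempty, preregular, and compact; (2) each best-response correspondence $\mathrm{BR}_i$ is continuous; and (3) every finite reduction has a pure-strategy Nash equilibrium. -}

module Defs where

open import Axiom.Extensionality.Propositional
  using (Extensionality; lower-extensionality)
open import Data.Bool.Base using (Bool; true; false; not; _∧_)
open import Data.Bool.Properties as Bool using ()
open import Data.Fin.Base using (Fin)
open import Data.List.Base using (List)
open import Data.List.Relation.Unary.All using (All)
open import Data.List.Relation.Unary.Any using (Any)
open import Data.Nat.Base using (ℕ)
open import Data.Product.Base using (Σ-syntax; ∃-syntax; _×_; _,_; proj₁; proj₂)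
open import Data.Sum.Base using (_⊎_)
open import Function.Base using (_∘_; const)
open import Function.Bundles using (_↔_)
open import Level using (Level; suc)
open import Relation.Binary.PropositionalEquality
  using (_≡_; _≢_; refl; sym; cong; subst)
open import Relation.Nullary.Decidable.Core
  using (Dec; yes; no; does; decidable-stable)
open import Relation.Nullary.Irrelevant using (Irrelevant)
open import Relation.Nullary.Negation.Core using (¬_; ¬¬-map; contradiction)

-- Choice-free classical mathematics is expressed by taking types as sets
-- (Axiom K makes every type a set), with function extensionality and
-- excluded middle for propositions as hypotheses.  Excluded middle must not
-- be assumed for arbitrary types, as in Axiom.ExcludedMiddle: deciding every
-- type yields a global choice operator.

PropositionalExcludedMiddle : (ℓ : Level) → Set (suc ℓ)
PropositionalExcludedMiddle ℓ = {P : Set ℓ} → Irrelevant P → Dec P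

-- Mere existence.  Under propositional excluded middle ¬ ¬ A is the
-- propositional truncation of A, whereas a plain Σ-type carries a chosen
-- witness and would make the axiom of choice provable.

∥_∥ : ∀ {ℓ} → Set ℓ → Set ℓ
∥ A ∥ = ¬ ¬ A

AxiomOfChoice : (ℓ : Level) → Set (suc ℓ)
AxiomOfChoice ℓ =
  {I : Set ℓ} (X : I → Set ℓ) → (∀ i → ∥ X i ∥) → ∥ (∀ i → X i) ∥

HasTwoElements : ∀ {ℓ} → Set ℓ → Set ℓ
HasTwoElements I = ∥ (∃[ i ] ∃[ j ] (_≢_ {A = I} i j)) ∥

IsFinite : ∀ {ℓ} → Set ℓ → Set ℓ
IsFinite A = ∥ (Σ[ n ∈ ℕ ] (Fin n ↔ A)) ∥

module Classical {ℓ : Level}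
                 (lem : PropositionalExcludedMiddle ℓ)
                 (ext : Extensionality ℓ ℓ) where

  -- There are exactly two truth values, so Bool-valued functions are all the
  -- subsets; this also keeps the power set of a small set small.

  ⌜_⌝ : Set ℓ → Bool
  ⌜ A ⌝ = not (does (lem {¬ A} λ _ _ → refl))

  ⌜⌝-intro : ∀ {A} → A → ⌜ A ⌝ ≡ true
  ⌜⌝-intro {A} a with lem {¬ A} (λ _ _ → refl)
  ... | yes ¬a = contradiction a ¬a
  ... | no  _  = refl

  ⌜⌝-elim : ∀ {A} → ⌜ A ⌝ ≡ true → ∥ A ∥
  ⌜⌝-elim {A} _  with lem {¬ A} (λ _ _ → refl)
  ⌜⌝-elim {A} () | yes _
  ⌜⌝-elim {A} _  | no ¬¬a = ¬¬a

  ⌜⌝-cong : ∀ {A B} → (A → B) → (B → ∥ A ∥) → ⌜ A ⌝ ≡ ⌜ B ⌝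
  ⌜⌝-cong {A} {B} f g with lem {¬ A} (λ _ _ → refl) | lem {¬ B} (λ _ _ → refl)
  ... | yes _   | yes _   = refl
  ... | no  _   | no  _   = refl
  ... | yes ¬a  | no  ¬¬b = contradiction (λ b → g b ¬a) ¬¬b
  ... | no  ¬¬a | yes ¬b  = contradiction (¬b ∘ f) ¬¬a

  𝒫 : Set ℓ → Set ℓ
  𝒫 X = X → Bool

  infix 4 _∈_ _∉_ _⊆_
  infixr 7 _∩_
  infixr 8 _⁻¹_

  _∈_ _∉_ : {X : Set ℓ} → X → 𝒫 X → Set
  x ∈ U = U x ≡ true
  x ∉ U = ¬ (x ∈ U)

  comprehension : {X : Set ℓ} → (X → Set ℓ) → 𝒫 X
  comprehension P x = ⌜ P x ⌝

  infix 0 comprehension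
  syntax comprehension (λ x → P) = ｛ x ∣ P ｝

  _⊆_ : {X : Set ℓ} → 𝒫 X → 𝒫 X → Set ℓ
  U ⊆ V = ∀ x → x ∈ U → x ∈ V

  ∅ full : {X : Set ℓ} → 𝒫 X
  ∅    _ = false
  full _ = true

  ∁ : {X : Set ℓ} → 𝒫 X → 𝒫 X
  ∁ U x = not (U x)

  _∩_ : {X : Set ℓ} → 𝒫 X → 𝒫 X → 𝒫 X
  (U ∩ V) x = U x ∧ V x

  ⋃ : {X : Set ℓ} → 𝒫 (𝒫 X) → 𝒫 X
  ⋃ 𝓤 = ｛ x ∣ ∃[ U ] (U ∈ 𝓤 × x ∈ U) ｝

  _⁻¹_ : {X Y : Set ℓ} → (X → Y) → 𝒫 Y → 𝒫 X
  (f ⁻¹ U) x = U (f x)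

  Elem : {X : Set ℓ} → 𝒫 X → Set ℓ
  Elem {X} U = Σ[ x ∈ X ] x ∈ U

  ∈-stable : {X : Set ℓ} {x : X} (U : 𝒫 X) → ∥ x ∈ U ∥ → x ∈ U
  ∈-stable {x = x} U = decidable-stable (U x Bool.≟ true)

  record IsTopology {X : Set ℓ} (𝓣 : 𝒫 (𝒫 X)) : Set ℓ where
    field
      ∅-open    : ∅ ∈ 𝓣
      full-open : full ∈ 𝓣
      ∩-open    : ∀ {U V} → U ∈ 𝓣 → V ∈ 𝓣 → U ∩ V ∈ 𝓣
      ⋃-open    : ∀ {𝓤} → 𝓤 ⊆ 𝓣 → ⋃ 𝓤 ∈ 𝓣

  record Space : Set (suc ℓ) where
    field
      Carrier    : Set ℓ
      Opens      : 𝒫 (𝒫 Carrier)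
      isTopology : IsTopology Opens

    open IsTopology isTopology public

  open Space using (Carrier; Opens)

  Continuous : (X Y : Space) → (Carrier X → Carrier Y) → Set ℓ
  Continuous X Y f = ∀ U → U ∈ Opens Y → f ⁻¹ U ∈ Opens X

  IsClosed : (X : Space) → 𝒫 (Carrier X) → Set
  IsClosed X K = ∁ K ∈ Opens X

  Distinguishable : (X : Space) → Carrier X → Carrier X → Set ℓ
  Distinguishable X x y =
    ∥ (∃[ U ] (U ∈ Opens X × ((x ∈ U × y ∉ U) ⊎ (y ∈ U × x ∉ U)))) ∥

  Preregular : Space → Set ℓ
  Preregular X = ∀ x y → Distinguishable X x y →
    ∥ (∃[ U ] ∃[ V ] (U ∈ Opens X × V ∈ Opens X × x ∈ U × y ∈ V
                      × (∀ z → z ∈ U → z ∉ V))) ∥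

  Compact : Space → Set ℓ
  Compact X = ∀ 𝓤 → 𝓤 ⊆ Opens X → (∀ x → x ∈ ⋃ 𝓤) →
    ∥ (Σ[ Us ∈ List (𝒫 (Carrier X)) ]
         (All (_∈ 𝓤) Us × (∀ x → Any (x ∈_) Us))) ∥

  -- The coarsest topology containing 𝓢.

  generatedBy : {X : Set ℓ} → 𝒫 (𝒫 X) → 𝒫 (𝒫 X)
  generatedBy 𝓢 = ｛ U ∣ (∀ 𝓣 → IsTopology 𝓣 → 𝓢 ⊆ 𝓣 → U ∈ 𝓣) ｝

  module _ {X : Set ℓ} {𝓢 : 𝒫 (𝒫 X)} where

    generatedBy-minimal : ∀ {𝓣} → IsTopology 𝓣 → 𝓢 ⊆ 𝓣 → generatedBy 𝓢 ⊆ 𝓣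
    generatedBy-minimal {𝓣} top 𝓢⊆𝓣 U U∈ =
      ∈-stable 𝓣 (¬¬-map (λ h → h 𝓣 top 𝓢⊆𝓣) (⌜⌝-elim U∈))

    generatedBy-contains : 𝓢 ⊆ generatedBy 𝓢
    generatedBy-contains U U∈ = ⌜⌝-intro (λ _ _ 𝓢⊆𝓣 → 𝓢⊆𝓣 U U∈)

    generatedBy-isTopology : IsTopology (generatedBy 𝓢)
    generatedBy-isTopology = record
      { ∅-open    = ⌜⌝-intro λ _ top _ → IsTopology.∅-open top
      ; full-open = ⌜⌝-intro λ _ top _ → IsTopology.full-open top
      ; ∩-open    = λ U∈ V∈ → ⌜⌝-intro λ _ top 𝓢⊆𝓣 →
          IsTopology.∩-open top (generatedBy-minimal top 𝓢⊆𝓣 _ U∈)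
                                (generatedBy-minimal top 𝓢⊆𝓣 _ V∈)
      ; ⋃-open    = λ 𝓤⊆ → ⌜⌝-intro λ _ top 𝓢⊆𝓣 →
          IsTopology.⋃-open top λ U U∈ →
            generatedBy-minimal top 𝓢⊆𝓣 U (𝓤⊆ U U∈)
      }

  generatedSpace : (X : Set ℓ) → 𝒫 (𝒫 X) → Space
  generatedSpace X 𝓢 = record
    { Carrier = X ; Opens = generatedBy 𝓢 ; isTopology = generatedBy-isTopology }

  ⋃-⁻¹ : {X Y : Set ℓ} (f : X → Y) (𝓤 : 𝒫 (𝒫 Y)) →
         ⋃ ｛ W ∣ ∃[ U ] (U ∈ 𝓤 × W ≡ f ⁻¹ U) ｝ ≡ f ⁻¹ ⋃ 𝓤
  ⋃-⁻¹ f 𝓤 = lower-extensionality ℓ ℓ ext λ x → sym (⌜⌝-cong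
    (λ { (U , U∈ , fx∈U) → f ⁻¹ U , ⌜⌝-intro (U , U∈ , refl) , fx∈U })
    (λ { (W , W∈ , x∈W) → ¬¬-map
           (λ { (U , U∈ , W≡) → U , U∈ , subst (x ∈_) W≡ x∈W })
           (⌜⌝-elim W∈) }))

  generatedBy-continuous :
    (X : Space) {Y : Set ℓ} {𝓢 : 𝒫 (𝒫 Y)} (f : Carrier X → Y) →
    (∀ U → U ∈ 𝓢 → f ⁻¹ U ∈ Opens X) → Continuous X (generatedSpace Y 𝓢) f
  generatedBy-continuous X f f⁻¹𝓢 = generatedBy-minimal
    {𝓣 = λ U → Opens X (f ⁻¹ U)}
    (record
      { ∅-open    = Space.∅-open X
      ; full-open = Space.full-open X
      ; ∩-open    = Space.∩-open X
      ; ⋃-open    = λ {𝓤} 𝓤⊆ → subst (_∈ Opens X) (⋃-⁻¹ f 𝓤)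
          (Space.⋃-open X λ W W∈ → ∈-stable (Opens X) (¬¬-map
            (λ { (U , U∈ , W≡) → subst (_∈ Opens X) (sym W≡) (𝓤⊆ U U∈) })
            (⌜⌝-elim W∈)))
      })
    f⁻¹𝓢

  -- A product of spaces may be empty even if all its factors are nonempty.

  ∏ : {I : Set ℓ} → (I → Space) → Space
  ∏ {I} S = generatedSpace ((i : I) → Carrier (S i))
    ｛ W ∣ ∃[ i ] ∃[ U ] (U ∈ Opens (S i) × W ≡ (λ s → s i) ⁻¹ U) ｝

  record ClosedSet (X : Space) : Set ℓ where
    field
      set      : 𝒫 (Carrier X)
      closed   : IsClosed X set
      nonempty : ∥ Elem set ∥

  open ClosedSet using (set)

  □ : {X : Space} → 𝒫 (Carrier X) → 𝒫 (ClosedSet X)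
  □ U = ｛ K ∣ set K ⊆ U ｝

  -- The sets □ U with U open contain □ full = full and satisfy
  -- □ U ∩ □ V = □ (U ∩ V), so they are a basis of the topology they generate:
  -- the upper Vietoris topology.

  C : Space → Space
  C X = generatedSpace (ClosedSet X) ｛ W ∣ ∃[ U ] (U ∈ Opens X × W ≡ □ U) ｝

  infix 5 _∖_

  _∖_ : (I : Set ℓ) → I → Set ℓ
  I ∖ i = Σ[ j ∈ I ] j ≢ i

  _₋_ : {I : Set ℓ} {A : I → Set ℓ} →
        (∀ i → A i) → (i : I) → (j : I ∖ i) → A (proj₁ j)
  (s ₋ i) j = s (proj₁ j)

  S₋ : {I : Set ℓ} → (I → Space) → I → Space
  S₋ {I} S i = ∏ {I ∖ i} (S ∘ proj₁)

  record Game : Set (suc ℓ) where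
    field
      I             : Set ℓ
      I-two         : HasTwoElements I
      S             : I → Space
      S-nonempty    : ∀ i → ∥ Carrier (S i) ∥
      BR            : ∀ i → Carrier (S₋ S i) → ClosedSet (S i)
      BR-continuous : ∀ i → Continuous (S₋ S i) (C (S i)) (BR i)

    Profile : Set ℓ
    Profile = Carrier (∏ S)

    IsPureNashEquilibrium : Profile → Set ℓ
    IsPureNashEquilibrium s = ∀ i → s i ∈ set (BR i (s ₋ i))

    HasPureNashEquilibrium : Set ℓ
    HasPureNashEquilibrium = ∥ (∃[ s ] IsPureNashEquilibrium s) ∥

  glue : {A : Set ℓ} (b : Bool) → (b ≡ true → A) → (not b ≡ true → A) → A
  glue true  f g = f refl
  glue false f g = g refl

  module Reduction (G : Game) (J : 𝒫 (Game.I G)) where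
    open Game G

    S-J : Elem J → Space
    S-J j = S (proj₁ j)

    S-∁J : Elem (∁ J) → Space
    S-∁J k = S (proj₁ k)

    module _ (p : Carrier (∏ S-∁J)) where

      extend : (i : Elem J) → Carrier (S₋ S-J i) → Carrier (S₋ S (proj₁ i))
      extend i s (k , k≢i) = glue (J k)
        (λ k∈J → s ((k , k∈J) , k≢i ∘ cong proj₁))
        (λ k∉J → p (k , k∉J))

      private
        const-open : (X : Space) (b : Bool) → const b ∈ Opens X
        const-open X true  = Space.full-open X
        const-open X false = Space.∅-open X

        glue-open : (X : Space) {A : Set ℓ} (U : 𝒫 A) (b : Bool)
                    (f : Carrier X → b ≡ true → A) (g : not b ≡ true → A) →
                    (∀ e → (λ x → f x e) ⁻¹ U ∈ Opens X) →
                    (λ x → glue b (f x) g) ⁻¹ U ∈ Opens X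
        glue-open X U true  f g f-open = f-open refl
        glue-open X U false f g f-open = const-open X (U (g refl))

      extend-continuous : ∀ i → Continuous (S₋ S-J i) (S₋ S (proj₁ i)) (extend i)
      extend-continuous i = generatedBy-continuous (S₋ S-J i) (extend i)
        λ W W∈ → ∈-stable (Opens (S₋ S-J i)) (¬¬-map
          (λ { ((k , k≢i) , U , U-open , refl) →
                 glue-open (S₋ S-J i) U (J k)
                   (λ s k∈J → s ((k , k∈J) , k≢i ∘ cong proj₁))
                   (λ k∉J → p (k , k∉J))
                   λ k∈J → generatedBy-contains _
                     (⌜⌝-intro (((k , k∈J) , k≢i ∘ cong proj₁)
                               , U , U-open , refl)) })
          (⌜⌝-elim W∈))

      reduction : HasTwoElements (Elem J) → Game
      reduction J-two = record
        { I             = Elem J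
        ; I-two         = J-two
        ; S             = S-J
        ; S-nonempty    = S-nonempty ∘ proj₁
        ; BR            = λ i → BR (proj₁ i) ∘ extend i
        ; BR-continuous = λ i W W-open → extend-continuous i _
                            (BR-continuous (proj₁ i) W W-open)
        }

  open Reduction public using (reduction)

  record WellSpecified (G : Game) : Set ℓ where
    open Game G
    field
      nonempty   : ∀ i → ∥ Carrier (S i) ∥
      preregular : ∀ i → Preregular (S i)
      compact    : ∀ i → Compact (S i)
      continuous : ∀ i → Continuous (S₋ S i) (C (S i)) (BR i)
      finite-reductions :
        ∀ (J : 𝒫 I) (J-two : HasTwoElements (Elem J)) → IsFinite (Elem J) →
        ∀ (p : Carrier (∏ (Reduction.S-∁J G J))) →
        Game.HasPureNashEquilibrium (reduction G J p J-two)

{-# OPTIONS --safe #-}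
-- Give every X i the indiscrete topology, which is compact and preregular, and
-- let every strategy be a best response.  Equilibria are then exactly choice
-- functions, and a finite reduction has one because finite choice needs no axiom.
module Submission where

open import Defs
open import Level using (Level; Lift; lift)
open import Axiom.Extensionality.Propositional using (Extensionality)
open import Data.Bool.Base using (Bool; true; false; _∧_)
open import Data.Fin.Properties using (sequence)
open import Data.List.Base using ([]; _∷_)
open import Data.List.Relation.Unary.All using ([]; _∷_)
open import Data.List.Relation.Unary.Any using (here)
open import Data.Product.Base using (_,_)
open import Data.Sum.Base using (_⊎_; inj₁; inj₂; [_,_])
open import Data.Unit.Polymorphic.Base using (⊤; tt)
open import Effect.Monad using (RawMonad)
open import Function.Base using (_∘_; const)
open import Function.Bundles using (Inverse)
open import Relation.Binary.PropositionalEquality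
  using (_≡_; refl; sym; trans; cong₂; subst)
open import Relation.Nullary.Negation using (¬¬-Monad)
open import Relation.Nullary.Negation.Core using (¬¬-map)

-- Double negation is applicative, so `sequence` moves it past a product over `Fin n`. The
-- enumeration of `A` is only merely given, but it may be unpacked because the goal is a negation.
finiteChoice : ∀ {ℓ} {A : Set ℓ} → IsFinite A →
               (Y : A → Set ℓ) → (∀ a → ∥ Y a ∥) → ∥ (∀ a → Y a) ∥
finiteChoice finite Y inhabited ¬choice = finite λ (n , Fin↔A) →
  let open Inverse Fin↔A in
  sequence (RawMonad.rawApplicative ¬¬-Monad) (inhabited ∘ to)
    λ y → ¬choice λ a → subst Y (strictlyInverseˡ a) (y (from a))

module _ {ℓ : Level} (lem : PropositionalExcludedMiddle ℓ) (ext : Extensionality ℓ ℓ) where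

  open Classical lem ext

  -- Constancy of `U` amounts to being `∅` or `full`, but spares the topology axioms a case split.
  indiscreteOpens : (X : Set ℓ) → 𝒫 (𝒫 X)
  indiscreteOpens X = ｛ U ∣ (∀ x y → U x ≡ U y) ｝

  indiscreteOpen-constant : ∀ {X U} → U ∈ indiscreteOpens X → ∀ {x y} → x ∈ U → y ∈ U
  indiscreteOpen-constant {U = U} U-open x∈U = ∈-stable U (¬¬-map
    (λ U-constant → trans (sym (U-constant _ _)) x∈U) (⌜⌝-elim U-open))

  indiscrete : Set ℓ → Space
  indiscrete X = record
    { Carrier    = X
    ; Opens      = indiscreteOpens X
    ; isTopology = record
      { ∅-open    = ⌜⌝-intro λ _ _ → refl
      ; full-open = ⌜⌝-intro λ _ _ → refl
      -- Membership is a Boolean equation, hence stable, so both mere constancy proofs can be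
      -- unpacked.
      ; ∩-open    = λ U-open V-open → ∈-stable (indiscreteOpens X) λ k →
          ⌜⌝-elim U-open λ U-constant → ⌜⌝-elim V-open λ V-constant →
          k (⌜⌝-intro λ x y → cong₂ _∧_ (U-constant x y) (V-constant x y))
      ; ⋃-open    = λ 𝓤-open → ⌜⌝-intro λ _ _ → ⌜⌝-cong
          (λ (U , U∈ , x∈U) → U , U∈ , indiscreteOpen-constant (𝓤-open U U∈) x∈U)
          (λ (U , U∈ , y∈U) k → k (U , U∈ , indiscreteOpen-constant (𝓤-open U U∈) y∈U))
      }
    }

  -- Vacuous: an open set containing one point contains every other.
  indiscrete-preregular : ∀ X → Preregular (indiscrete X)
  indiscrete-preregular X x y distinguishable _ = distinguishable λ where
    (U , U-open , inj₁ (x∈U , y∉U)) → y∉U (indiscreteOpen-constant U-open x∈U)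
    (U , U-open , inj₂ (y∈U , x∉U)) → x∉U (indiscreteOpen-constant U-open y∈U)

  -- The member of the cover that contains some point `x` is already everything, so it alone is a
  -- subcover.
  indiscrete-compact : ∀ {X} → ∥ X ∥ → Compact (indiscrete X)
  indiscrete-compact inhabited 𝓤 𝓤-open cover k =
    inhabited λ x → ⌜⌝-elim (cover x) λ (U , U∈ , x∈U) →
    k (U ∷ [] , U∈ ∷ [] , λ y → here (indiscreteOpen-constant (𝓤-open U U∈) x∈U))

  fullClosed : (X : Space) → ∥ Space.Carrier X ∥ → ClosedSet X
  fullClosed X inhabited = record
    { set      = full
    ; closed   = Space.∅-open X
    ; nonempty = ¬¬-map (_, refl) inhabited
    }

  -- A preimage has the constant value `U y`, so it is `full` or `∅`. Hence the product and upper
  -- Vietoris topologies need no analysis.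
  const-continuous : (X Y : Space) (y : Space.Carrier Y) → Continuous X Y (const y)
  const-continuous X Y y U _ with U y
  ... | true  = Space.full-open X
  ... | false = Space.∅-open X

  module _ {I : Set ℓ} (I-two : HasTwoElements I)
           (X : I → Set ℓ) (inhabited : ∀ i → ∥ X i ∥) where

    indifferentGame : Game
    indifferentGame = record
      { I             = I
      ; I-two         = I-two
      ; S             = S
      ; S-nonempty    = inhabited
      ; BR            = λ i _ → fullClosed (S i) (inhabited i)
      ; BR-continuous = λ i →
          const-continuous (S₋ S i) (C (S i)) (fullClosed (S i) (inhabited i))
      }
      where S = indiscrete ∘ X

    indifferentGame-wellSpecified : WellSpecified indifferentGame
    indifferentGame-wellSpecified = record
      { nonempty          = inhabited
      ; preregular        = indiscrete-preregular ∘ X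
      ; compact           = indiscrete-compact ∘ inhabited
      ; continuous        = Game.BR-continuous indifferentGame
      -- Membership in `full` computes to `true`, so any profile of the players in `J` is an
      -- equilibrium.
      ; finite-reductions = λ J J-two J-finite p → ¬¬-map (_, λ _ → refl)
          (finiteChoice J-finite (λ (i , _) → X i) (λ (i , _) → inhabited i))
      }

theorem5 : ∀ {ℓ : Level} (lem : PropositionalExcludedMiddle ℓ) (ext : Extensionality ℓ ℓ) →
    let open Classical lem ext in
    (∀ (G : Game) → WellSpecified G → Game.HasPureNashEquilibrium G) →
    AxiomOfChoice ℓ
theorem5 {ℓ} lem ext equilibria {I} X inhabited =
  -- Forgetting the added players turns an equilibrium profile into a choice function for `X`.
  ¬¬-map (λ (s , _) i → s (inj₁ i))
    (equilibria (indifferentGame lem ext two X⁺ inhabited⁺)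
                (indifferentGame-wellSpecified lem ext two X⁺ inhabited⁺))
  where
  -- The two extra players make up for I possibly having fewer than two elements.
  I⁺ : Set ℓ
  I⁺ = I ⊎ Lift ℓ Bool

  two : HasTwoElements I⁺
  two k = k (inj₂ (lift true) , inj₂ (lift false) , λ ())

  X⁺ : I⁺ → Set ℓ
  X⁺ = [ X , const ⊤ ]

  inhabited⁺ : ∀ i → ∥ X⁺ i ∥
  inhabited⁺ (inj₁ i) = inhabited i
  inhabited⁺ (inj₂ _) k = k tt
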